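{- For every integer $t\ge 3$, there exists a pair of non $\epsilon$-cospectral $\epsilon$-equienergetic graphs on $6t+1$ vertices.
   Context: All graphs are finite, simple, undirected and connected. For a connected graph $G$ with distance function $d$, the eccentricity of a vertex $v$ is $e(v)=\max\{d(v,u):u\in V(G)\}$. The eccentricity matrix $\epsilon(G)$ is the symmetric matrix indexed by $V(G)$ with $(u,v)$ entry $d(u,v)$ if $d(u,v)=\min\{e(u),e(v)\}$, and $0$ otherwise. The $\epsilon$-spectrum of $G$ is the multiset of eigenvalues of $\epsilon(G)$, and the $\epsilon$-energy $E_\epsilon(G)$ is the sum of the absolute values of these eigenvalues (with multiplicity). Two non-isomorphic graphs of the same order are $\epsilon$-cospectral if they have the same $\epsilon$-spectrum, and non $\epsilon$-cospectral otherwise. Two graphs of the same order are $\epsilon$-equienergetic if they have the same $\epsilon$-energy. -}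

module Defs where

open import Algebra.Bundles.Raw using (RawRing)
import Algebra.Definitions.RawSemiring as RawSemiringDefs
open import Data.Bool.Base using (if_then_else_)
open import Data.Fin.Base using (Fin; zero; suc; toℕ; punchIn)
import Data.Fin.Properties as Fin
open import Data.Fin.Permutation using (Permutation′; _⟨$⟩ʳ_)
import Data.Integer.Base as ℤ
open import Data.Nat.Base as ℕ using (ℕ; zero; suc; _⊔_; _⊓_; z≤n; s≤s)
import Data.Nat.Properties as ℕ
open import Data.Product.Base using (∃; _×_; _,_; proj₁)
open import Data.Rational.Base as ℚ using (ℚ; 0ℚ; 1ℚ; ½)
import Data.Rational.Properties as ℚ
open import Data.Rational.Solver using (module +-*-Solver)
open import Data.Sum.Base using (_⊎_; inj₁; inj₂)
open import Data.Vec.Functional using (Vector; foldr)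
open import Function.Bundles using (_⇔_)
open import Level using (Level; 0ℓ)
open import Relation.Binary.Core using (Rel)
open import Relation.Binary.Definitions using (Decidable; Irreflexive; Symmetric)
open import Relation.Binary.PropositionalEquality
open import Relation.Nullary using (Dec; ¬_; yes; no; does)
open import Relation.Nullary.Decidable using (map′; _×-dec_)
open import Relation.Nullary.Negation using (contradiction)

-- Real numbers: Cauchy sequences of rationals (with a modulus), compared
-- by the equivalence relation _≃_.

Cauchy : (ℕ → ℚ) → Set
Cauchy x = ∀ ε → 0ℚ ℚ.< ε →
  ∃ λ N → ∀ m n → N ℕ.≤ m → N ℕ.≤ n → ℚ.∣ x m ℚ.- x n ∣ ℚ.< ε

record ℝ : Set where
  constructor mkℝ
  field
    seq    : ℕ → ℚ
    cauchy : Cauchy seq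

open ℝ public

infix 4 _≃_

record _≃_ (x y : ℝ) : Set where
  constructor mk≃
  field
    close : ∀ ε → 0ℚ ℚ.< ε →
      ∃ λ N → ∀ n → N ℕ.≤ n → ℚ.∣ seq x n ℚ.- seq y n ∣ ℚ.< ε

open _≃_ public

open +-*-Solver using (solve; _:+_; _:*_; _:-_; :-_; con; _:=_)

half-pos : ∀ {ε} → 0ℚ ℚ.< ε → 0ℚ ℚ.< ½ ℚ.* ε
half-pos {ε} 0<ε = subst (ℚ._< ½ ℚ.* ε) (ℚ.*-zeroʳ ½) (ℚ.*-monoʳ-<-pos ½ 0<ε)

half+half : ∀ ε → ½ ℚ.* ε ℚ.+ ½ ℚ.* ε ≡ ε
half+half = solve 1 (λ e → con ½ :* e :+ con ½ :* e := e) refl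

sub-add : ∀ a b → a ≡ (a ℚ.- b) ℚ.+ b
sub-add = solve 2 (λ a b → a := (a :- b) :+ b) refl

add-sub : ∀ a b → (a ℚ.+ b) ℚ.- b ≡ a
add-sub = solve 2 (λ a b → (a :+ b) :- b := a) refl

flip-sub : ∀ a b → ℚ.- (a ℚ.- b) ≡ b ℚ.- a
flip-sub = solve 2 (λ a b → :- (a :- b) := b :- a) refl

regroup-+ : ∀ a b c d → (a ℚ.+ b) ℚ.- (c ℚ.+ d) ≡ (a ℚ.- c) ℚ.+ (b ℚ.- d)
regroup-+ = solve 4
  (λ a b c d → (a :+ b) :- (c :+ d) := (a :- c) :+ (b :- d)) refl

regroup-* : ∀ a b c d →
  a ℚ.* b ℚ.- c ℚ.* d ≡ a ℚ.* (b ℚ.- d) ℚ.+ d ℚ.* (a ℚ.- c)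
regroup-* = solve 4
  (λ a b c d → a :* b :- c :* d := a :* (b :- d) :+ d :* (a :- c)) refl

const-cauchy : ∀ q → Cauchy (λ _ → q)
const-cauchy q ε 0<ε = 0 , λ _ _ _ _ →
  subst (λ p → ℚ.∣ p ∣ ℚ.< ε) (sym (ℚ.+-inverseʳ q)) 0<ε

+-cauchy : ∀ {x y} → Cauchy x → Cauchy y → Cauchy (λ n → x n ℚ.+ y n)
+-cauchy {x} {y} cx cy ε 0<ε
  with cx _ (half-pos 0<ε) | cy _ (half-pos 0<ε)
... | M , px | N , py = M ⊔ N , λ m n Q≤m Q≤n → begin-strict
  ℚ.∣ (x m ℚ.+ y m) ℚ.- (x n ℚ.+ y n) ∣
    ≡⟨ cong ℚ.∣_∣ (regroup-+ (x m) (y m) (x n) (y n)) ⟩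
  ℚ.∣ (x m ℚ.- x n) ℚ.+ (y m ℚ.- y n) ∣
    ≤⟨ ℚ.∣p+q∣≤∣p∣+∣q∣ (x m ℚ.- x n) (y m ℚ.- y n) ⟩
  ℚ.∣ x m ℚ.- x n ∣ ℚ.+ ℚ.∣ y m ℚ.- y n ∣
    <⟨ ℚ.+-mono-< (px m n (ℕ.m⊔n≤o⇒m≤o M N Q≤m) (ℕ.m⊔n≤o⇒m≤o M N Q≤n))
                  (py m n (ℕ.m⊔n≤o⇒n≤o M N Q≤m) (ℕ.m⊔n≤o⇒n≤o M N Q≤n)) ⟩
  ½ ℚ.* ε ℚ.+ ½ ℚ.* ε
    ≡⟨ half+half ε ⟩
  ε ∎
  where open ℚ.≤-Reasoning

-‿cauchy : ∀ {x} → Cauchy x → Cauchy (λ n → ℚ.- x n)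
-‿cauchy {x} cx ε 0<ε with cx ε 0<ε
... | N , px = N , λ m n N≤m N≤n → subst (ℚ._< ε)
  (trans (sym (ℚ.∣-p∣≡∣p∣ (x m ℚ.- x n)))
         (cong ℚ.∣_∣ (ℚ.neg-distrib-+ (x m) (ℚ.- x n))))
  (px m n N≤m N≤n)

reverse-triangle : ∀ p q → ℚ.∣ ℚ.∣ p ∣ ℚ.- ℚ.∣ q ∣ ∣ ℚ.≤ ℚ.∣ p ℚ.- q ∣
reverse-triangle p q = helper (ℚ.∣p∣≡p∨∣p∣≡-p s)
  where
  open ℚ.≤-Reasoning

  bound : ∀ a b → ℚ.∣ a ∣ ℚ.- ℚ.∣ b ∣ ℚ.≤ ℚ.∣ a ℚ.- b ∣
  bound a b = begin
    ℚ.∣ a ∣ ℚ.- ℚ.∣ b ∣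
      ≡⟨ cong (λ c → ℚ.∣ c ∣ ℚ.- ℚ.∣ b ∣) (sub-add a b) ⟩
    ℚ.∣ (a ℚ.- b) ℚ.+ b ∣ ℚ.- ℚ.∣ b ∣
      ≤⟨ ℚ.+-monoˡ-≤ (ℚ.- ℚ.∣ b ∣) (ℚ.∣p+q∣≤∣p∣+∣q∣ (a ℚ.- b) b) ⟩
    (ℚ.∣ a ℚ.- b ∣ ℚ.+ ℚ.∣ b ∣) ℚ.- ℚ.∣ b ∣
      ≡⟨ add-sub ℚ.∣ a ℚ.- b ∣ ℚ.∣ b ∣ ⟩
    ℚ.∣ a ℚ.- b ∣ ∎

  s = ℚ.∣ p ∣ ℚ.- ℚ.∣ q ∣

  helper : ℚ.∣ s ∣ ≡ s ⊎ ℚ.∣ s ∣ ≡ ℚ.- s → ℚ.∣ s ∣ ℚ.≤ ℚ.∣ p ℚ.- q ∣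
  helper (inj₁ eq) = subst (ℚ._≤ ℚ.∣ p ℚ.- q ∣) (sym eq) (bound p q)
  helper (inj₂ eq) = begin
    ℚ.∣ s ∣              ≡⟨ eq ⟩
    ℚ.- s                ≡⟨ flip-sub ℚ.∣ p ∣ ℚ.∣ q ∣ ⟩
    ℚ.∣ q ∣ ℚ.- ℚ.∣ p ∣  ≤⟨ bound q p ⟩
    ℚ.∣ q ℚ.- p ∣        ≡⟨ cong ℚ.∣_∣ (sym (flip-sub p q)) ⟩
    ℚ.∣ ℚ.- (p ℚ.- q) ∣  ≡⟨ ℚ.∣-p∣≡∣p∣ (p ℚ.- q) ⟩
    ℚ.∣ p ℚ.- q ∣        ∎

∣∣-cauchy : ∀ {x} → Cauchy x → Cauchy (λ n → ℚ.∣ x n ∣)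
∣∣-cauchy {x} cx ε 0<ε with cx ε 0<ε
... | N , px = N , λ m n N≤m N≤n →
  ℚ.≤-<-trans (reverse-triangle (x m) (x n)) (px m n N≤m N≤n)

eventually-bounded : ∀ {x} → Cauchy x →
  ∃ λ B → ℚ.Positive B × ∃ λ N → ∀ n → N ℕ.≤ n → ℚ.∣ x n ∣ ℚ.≤ B
eventually-bounded {x} cx with cx 1ℚ (ℚ.positive⁻¹ 1ℚ)
... | N , px = 1ℚ ℚ.+ ℚ.∣ x N ∣ , B-pos , N , bound
  where
  open ℚ.≤-Reasoning

  B-pos : ℚ.Positive (1ℚ ℚ.+ ℚ.∣ x N ∣)
  B-pos = ℚ.positive
    (ℚ.+-mono-<-≤ (ℚ.positive⁻¹ 1ℚ) (ℚ.0≤∣p∣ (x N)))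

  bound : ∀ n → N ℕ.≤ n → ℚ.∣ x n ∣ ℚ.≤ 1ℚ ℚ.+ ℚ.∣ x N ∣
  bound n N≤n = begin
    ℚ.∣ x n ∣
      ≡⟨ cong ℚ.∣_∣ (sub-add (x n) (x N)) ⟩
    ℚ.∣ (x n ℚ.- x N) ℚ.+ x N ∣
      ≤⟨ ℚ.∣p+q∣≤∣p∣+∣q∣ (x n ℚ.- x N) (x N) ⟩
    ℚ.∣ x n ℚ.- x N ∣ ℚ.+ ℚ.∣ x N ∣
      ≤⟨ ℚ.+-monoˡ-≤ ℚ.∣ x N ∣ (ℚ.<⇒≤ (px n N N≤n ℕ.≤-refl)) ⟩
    1ℚ ℚ.+ ℚ.∣ x N ∣ ∎

divide : ∀ B → ℚ.Positive B → ∀ {ε} → 0ℚ ℚ.< ε →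
  ∃ λ δ → 0ℚ ℚ.< δ × B ℚ.* δ ≡ ε
divide B B-pos {ε} 0<ε = B⁻¹ ℚ.* ε , 0<δ , Bδ≡ε
  where
  instance
    _ = B-pos
    _ = ℚ.pos⇒nonZero B
  B⁻¹ = ℚ.1/ B
  0<δ : 0ℚ ℚ.< B⁻¹ ℚ.* ε
  0<δ = subst (ℚ._< B⁻¹ ℚ.* ε) (ℚ.*-zeroʳ B⁻¹)
    (ℚ.*-monoʳ-<-pos B⁻¹ {{ℚ.1/pos⇒pos B}} 0<ε)
  Bδ≡ε : B ℚ.* (B⁻¹ ℚ.* ε) ≡ ε
  Bδ≡ε = trans (sym (ℚ.*-assoc B B⁻¹ ε))
    (trans (cong (ℚ._* ε) (ℚ.*-inverseʳ B)) (ℚ.*-identityˡ ε))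

*-bound : ∀ B → ℚ.Positive B → ∀ p q {δ η} → B ℚ.* δ ≡ η →
  ℚ.∣ p ∣ ℚ.≤ B → ℚ.∣ q ∣ ℚ.< δ → ℚ.∣ p ℚ.* q ∣ ℚ.< η
*-bound B B-pos p q {δ} {η} Bδ≡η p≤B q<δ = begin-strict
  ℚ.∣ p ℚ.* q ∣
    ≡⟨ ℚ.∣p*q∣≡∣p∣*∣q∣ p q ⟩
  ℚ.∣ p ∣ ℚ.* ℚ.∣ q ∣
    ≤⟨ ℚ.*-monoʳ-≤-nonNeg ℚ.∣ q ∣ {{ℚ.∣-∣-nonNeg q}} p≤B ⟩
  B ℚ.* ℚ.∣ q ∣
    <⟨ ℚ.*-monoʳ-<-pos B {{B-pos}} q<δ ⟩
  B ℚ.* δ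
    ≡⟨ Bδ≡η ⟩
  η ∎
  where open ℚ.≤-Reasoning

*-close : ∀ a b c d ε →
  ℚ.∣ a ℚ.* (b ℚ.- d) ∣ ℚ.< ½ ℚ.* ε → ℚ.∣ d ℚ.* (a ℚ.- c) ∣ ℚ.< ½ ℚ.* ε →
  ℚ.∣ a ℚ.* b ℚ.- c ℚ.* d ∣ ℚ.< ε
*-close a b c d ε p q = begin-strict
  ℚ.∣ a ℚ.* b ℚ.- c ℚ.* d ∣
    ≡⟨ cong ℚ.∣_∣ (regroup-* a b c d) ⟩
  ℚ.∣ a ℚ.* (b ℚ.- d) ℚ.+ d ℚ.* (a ℚ.- c) ∣
    ≤⟨ ℚ.∣p+q∣≤∣p∣+∣q∣ (a ℚ.* (b ℚ.- d)) (d ℚ.* (a ℚ.- c)) ⟩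
  ℚ.∣ a ℚ.* (b ℚ.- d) ∣ ℚ.+ ℚ.∣ d ℚ.* (a ℚ.- c) ∣
    <⟨ ℚ.+-mono-< p q ⟩
  ½ ℚ.* ε ℚ.+ ½ ℚ.* ε
    ≡⟨ half+half ε ⟩
  ε ∎
  where open ℚ.≤-Reasoning

*-cauchy : ∀ {x y} → Cauchy x → Cauchy y → Cauchy (λ n → x n ℚ.* y n)
*-cauchy {x} {y} cx cy ε 0<ε =
  let A , A-pos , K , x≤A = eventually-bounded cx
      B , B-pos , L , y≤B = eventually-bounded cy
      α , 0<α , Aα≡       = divide A A-pos (half-pos 0<ε)
      β , 0<β , Bβ≡       = divide B B-pos (half-pos 0<ε)
      M , py              = cy α 0<α
      N , px              = cx β 0<β
      π₁ : ∀ {i} → (K ⊔ L) ⊔ (M ⊔ N) ℕ.≤ i → K ⊔ L ℕ.≤ i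
      π₁ = ℕ.m⊔n≤o⇒m≤o (K ⊔ L) (M ⊔ N)
      π₂ : ∀ {i} → (K ⊔ L) ⊔ (M ⊔ N) ℕ.≤ i → M ⊔ N ℕ.≤ i
      π₂ = ℕ.m⊔n≤o⇒n≤o (K ⊔ L) (M ⊔ N)
  in (K ⊔ L) ⊔ (M ⊔ N) , λ m n Q≤m Q≤n →
    *-close (x m) (y m) (x n) (y n) ε
      (*-bound A A-pos (x m) (y m ℚ.- y n) Aα≡
        (x≤A m (ℕ.m⊔n≤o⇒m≤o K L (π₁ Q≤m)))
        (py m n (ℕ.m⊔n≤o⇒m≤o M N (π₂ Q≤m)) (ℕ.m⊔n≤o⇒m≤o M N (π₂ Q≤n))))
      (*-bound B B-pos (y n) (x m ℚ.- x n) Bβ≡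
        (y≤B n (ℕ.m⊔n≤o⇒n≤o K L (π₁ Q≤n)))
        (px m n (ℕ.m⊔n≤o⇒n≤o M N (π₂ Q≤m)) (ℕ.m⊔n≤o⇒n≤o M N (π₂ Q≤n))))

fromℚ : ℚ → ℝ
fromℚ q = mkℝ (λ _ → q) (const-cauchy q)

fromℕ : ℕ → ℝ
fromℕ k = fromℚ (ℤ.+ k ℚ./ 1)

infixl 6 _+_ _-_
infixl 7 _*_
infix  8 -_

_+_ : ℝ → ℝ → ℝ
x + y = mkℝ (λ n → seq x n ℚ.+ seq y n)
  (+-cauchy {seq x} {seq y} (cauchy x) (cauchy y))

_*_ : ℝ → ℝ → ℝ
x * y = mkℝ (λ n → seq x n ℚ.* seq y n)
  (*-cauchy {seq x} {seq y} (cauchy x) (cauchy y))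

-_ : ℝ → ℝ
- x = mkℝ (λ n → ℚ.- seq x n) (-‿cauchy {seq x} (cauchy x))

_-_ : ℝ → ℝ → ℝ
x - y = x + (- y)

∣_∣ : ℝ → ℝ
∣ x ∣ = mkℝ (λ n → ℚ.∣ seq x n ∣) (∣∣-cauchy {seq x} (cauchy x))

ℝ-rawRing : RawRing 0ℓ 0ℓ
ℝ-rawRing = record
  { Carrier = ℝ
  ; _≈_     = _≃_
  ; _+_     = _+_
  ; _*_     = _*_
  ; -_      = -_
  ; 0#      = fromℚ 0ℚ
  ; 1#      = fromℚ 1ℚ
  }

Matrix : ∀ {a} → Set a → ℕ → Set a
Matrix A n = Fin n → Fin n → A

module _ {c ℓ : Level} (R : RawRing c ℓ) where
  private
    module R = RawRing R
    open RawSemiringDefs R.rawSemiring using (sum; _^_)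

  -- Laplace expansion along the first row.
  det : ∀ {n} → Matrix R.Carrier n → R.Carrier
  det {zero}  A = R.1#
  det {suc n} A = sum λ j →
    ((R.- R.1#) ^ toℕ j) R.* (A zero j R.* det (λ r s → A (suc r) (punchIn j s)))

open RawSemiringDefs (RawRing.rawSemiring ℝ-rawRing) public
  using (sum; product)

identity : ∀ {n} → Matrix ℝ n
identity i j = if does (i Fin.≟ j) then fromℚ 1ℚ else fromℚ 0ℚ

-- The characteristic polynomial det(xI - A), as a function of the real x.
charPoly : ∀ {n} → Matrix ℝ n → ℝ → ℝ
charPoly A x = det ℝ-rawRing (λ i j → x * identity i j - A i j)

-- The n entries of λs are the eigenvalues of A, listed with multiplicity
-- (in any order): det(xI - A) = ∏ᵢ (x - λsᵢ).  Two real polynomials are equal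
-- exactly when they agree at every real x.
IsSpectrum : ∀ {n} → Matrix ℝ n → Vector ℝ n → Set
IsSpectrum A λs = ∀ x → charPoly A x ≃ product (λ i → x - λs i)

infixr 5 _∷_

data Walk {n} (Adj : Rel (Fin n) 0ℓ) : ℕ → Rel (Fin n) 0ℓ where
  []  : ∀ {u} → Walk Adj 0 u u
  _∷_ : ∀ {k u w v} → Adj u w → Walk Adj k w v → Walk Adj (suc k) u v

-- Finite simple undirected connected graphs with vertex set Fin n.
record Graph (n : ℕ) : Set₁ where
  field
    Adj       : Rel (Fin n) 0ℓ
    adj?      : Decidable Adj
    symmetric : Symmetric Adj
    loopless  : Irreflexive _≡_ Adj
    connected : ∀ u v → ∃ λ k → Walk Adj k u v

least : ∀ {P : ℕ → Set} → (∀ k → Dec (P k)) → ∀ k → P k →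
  ∃ λ m → P m × (∀ j → P j → m ℕ.≤ j)
least P? zero p = 0 , p , λ _ _ → z≤n
least {P} P? (suc k) p with P? 0
... | yes p₀ = 0 , p₀ , λ _ _ → z≤n
... | no ¬p₀ with least {λ j → P (suc j)} (λ j → P? (suc j)) k p
...   | m , q , m-min = suc m , q , λ where
        zero    p₀ → contradiction p₀ ¬p₀
        (suc j) pj → s≤s (m-min j pj)

module _ {n} (G : Graph n) where
  open Graph G

  walk? : ∀ k u v → Dec (Walk Adj k u v)
  walk? zero u v = map′ (λ { refl → [] }) (λ { [] → refl }) (u Fin.≟ v)
  walk? (suc k) u v = map′
    (λ { (_ , a , p) → a ∷ p })
    (λ { (a ∷ p) → _ , a , p })
    (Fin.any? λ w → adj? u w ×-dec walk? k w v)

  -- The length of a shortest walk (equivalently, of a shortest path).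
  dist : Fin n → Fin n → ℕ
  dist u v =
    let k , p = connected u v in proj₁ (least (λ k → walk? k u v) k p)

  ecc : Fin n → ℕ
  ecc v = foldr _⊔_ 0 (λ u → dist v u)

  -- The eccentricity matrix ε(G).
  eccMatrix : Matrix ℝ n
  eccMatrix u v =
    if does (dist u v ℕ.≟ ecc u ⊓ ecc v) then fromℕ (dist u v) else fromℕ 0

  -- e is the ε-energy of G; the listing λs is determined up to order.
  IsEnergy : ℝ → Set
  IsEnergy e =
    ∃ λ (λs : Vector ℝ n) → IsSpectrum eccMatrix λs × sum (λ i → ∣ λs i ∣) ≃ e

Isomorphic : ∀ {n} → Graph n → Graph n → Set
Isomorphic {n} G H = ∃ λ (π : Permutation′ n) →
  ∀ u v → Graph.Adj G u v ⇔ Graph.Adj H (π ⟨$⟩ʳ u) (π ⟨$⟩ʳ v)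

SameSpectrum : ∀ {n} → Graph n → Graph n → Set
SameSpectrum {n} G H = ∃ λ (λs : Vector ℝ n) →
  IsSpectrum (eccMatrix G) λs × IsSpectrum (eccMatrix H) λs

-- Being non ε-cospectral is a property of pairs of non-isomorphic graphs.
NonCospectral : ∀ {n} → Graph n → Graph n → Set
NonCospectral G H = ¬ Isomorphic G H × ¬ SameSpectrum G H

Equienergetic : ∀ {n} → Graph n → Graph n → Set
Equienergetic G H = ∃ λ e → IsEnergy G e × IsEnergy H e

{-# OPTIONS --safe #-}
module Submission where

-- Take the complete bipartite graphs K₂,ₙ₋₂ and K₃,ₙ₋₃ with n = 6t + 1.  All
-- eccentricities in K_a,b (a, b ≥ 2) are 2, so ε(K_a,b) = 2(J_a - I) ⊕ 2(J_b - I):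
-- edges contribute 0 and pairs on the same side contribute 2.  The ε-eigenvalues
-- are 2(a - 1), 2(b - 1) and, n - 2 times, -2; hence the ε-energy 4(n - 2) does
-- not depend on a.  But 2 is an ε-eigenvalue when a = 2 and not when a = 3.
-- Since all eigenvalues are rational, the spectra are computed over ℚ, separately
-- at each index of the Cauchy sequences.

open import Defs as Defs using (Graph; NonCospectral; Equienergetic)
open import Data.Nat.Base using (ℕ; _≤_)
open import Data.Product.Base using (∃₂; _×_)

import Algebra.Apartness.Properties.HeytingCommutativeRing as HeytingProperties
open import Algebra.Bundles using (CommutativeRing)
open import Algebra.Bundles.Raw using (RawRing)
import Algebra.Definitions.RawSemiring as RawSemiringDefs
import Algebra.Properties.CommutativeSemigroup as CommutativeSemigroupProperties
import Algebra.Properties.Ring as RingProperties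
import Algebra.Properties.Semiring.Sum as SemiringSum
open import Data.Bool.Base using (Bool; true; false; not; if_then_else_)
import Data.Bool.Properties as Bool
open import Data.Fin.Base
  using (Fin; zero; suc; toℕ; punchIn; fromℕ<; inject≤; _↑ˡ_; _↑ʳ_)
open import Data.Fin.Patterns using (0F; 1F; 2F)
open import Data.Fin.Permutation using (_⟨$⟩ʳ_; _⟨$⟩ˡ_; inverseʳ)
import Data.Fin.Properties as Fin
import Data.Integer.Base as ℤ
open import Data.Nat.Base using (zero; suc; z≤n; s≤s; _<_; _⊔_; _⊓_)
import Data.Nat.Properties as ℕ
open import Data.Product.Base using (∃; _,_)
open import Data.Rational.Base as ℚ using (ℚ; 0ℚ; 1ℚ)
import Data.Rational.Properties as ℚ
open import Data.Rational.Solver using (module +-*-Solver)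
open import Data.Vec.Functional using (Vector; _∷_; foldr)
open import Function.Base using (_∘_)
open import Function.Bundles using (_⇔_; Equivalence)
open import Function.Construct.Identity using (⇔-id)
open import Relation.Binary.Definitions using (tri<; tri≈; tri>)
open import Relation.Binary.PropositionalEquality as ≡ using (_≡_; _≢_)
import Relation.Binary.Reasoning.Setoid as SetoidReasoning
open import Relation.Nullary using (¬_; yes; no; does)
open import Relation.Nullary.Decidable using (¬?; dec-true; decidable-stable; from-yes)
open import Relation.Nullary.Negation using (contradiction)

-- Marks the first `k` vertices as one side of the bipartition. Dropping vertex zero lowers a
-- positive `k` by one, in step with the recursion of `shifts`.
initial : ∀ {n} → ℕ → Fin n → Bool
initial zero    _       = false
initial (suc k) zero    = true
initial (suc k) (suc i) = initial k i

-- Determinants over a commutative ring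

module Determinant {c ℓ} (R : CommutativeRing c ℓ) where
  open CommutativeRing R hiding (zero)
  open Defs using (Matrix; det)
  open RawSemiringDefs (RawRing.rawSemiring rawRing) using (_^_; product)
  open SemiringSum semiring
    using (sum; sum-cong-≋; *-distribˡ-sum; ∑-distrib-+; ∑-comm; sum-replicate-zero)
  open CommutativeSemigroupProperties *-commutativeSemigroup
    using (x∙yz≈y∙xz)
  open CommutativeSemigroupProperties +-commutativeSemigroup
    using (interchange)
    renaming (x∙yz≈y∙xz to x∙yz≈y∙xz+)
  open RingProperties ring using (-1*x≈-x; -‿+-comm)
  open SetoidReasoning setoid

  ∣_∣ : ∀ {n} → Matrix Carrier n → Carrier
  ∣ A ∣ = det rawRing A

  sgn : ∀ {n} → Fin n → Carrier
  sgn i = (- 1#) ^ toℕ i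

  minor : ∀ {n} → Matrix Carrier (suc n) → Fin (suc n) → Fin (suc n) →
          Matrix Carrier n
  minor A i j r s = A (punchIn i r) (punchIn j s)

  sum-zero : ∀ {n} {f : Vector Carrier n} → (∀ i → f i ≈ 0#) → sum f ≈ 0#
  sum-zero {n} f≈0 = trans (sum-cong-≋ f≈0) (sum-replicate-zero n)

  *-zero-middle : ∀ {a b} d → b ≈ 0# → a * (b * d) ≈ 0#
  *-zero-middle {a} d b≈0 =
    trans (*-congˡ (trans (*-congʳ b≈0) (zeroˡ d))) (zeroʳ a)

  det-cong : ∀ {n} {A B : Matrix Carrier n} → (∀ i j → A i j ≈ B i j) →
             ∣ A ∣ ≈ ∣ B ∣
  det-cong {zero}  A≈B = refl
  det-cong {suc n} A≈B = sum-cong-≋ λ j → *-congˡ {x = sgn j}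
    (*-cong (A≈B zero j) (det-cong λ r s → A≈B (suc r) (punchIn j s)))

  -- Induction: expanding each minor of the first row along its own first column gives a double sum
  -- over the same second-order minors as the column expansion. Both orders carry a single extra
  -- factor `- 1#`, so `exchange` matches them term by term.
  det-column : ∀ {n} (A : Matrix Carrier (suc n)) →
    ∣ A ∣ ≈ sum λ i → sgn i * (A i zero * ∣ minor A i zero ∣)
  det-column {zero}  A = refl
  det-column {suc n} A = +-congˡ (begin
    (sum λ j → sgn (suc j) * (A zero (suc j) * ∣ minor A zero (suc j) ∣))
      ≈⟨ (sum-cong-≋ λ j → *-congˡ {x = sgn (suc j)}
           (*-congˡ {x = A zero (suc j)} (det-column (minor A zero (suc j))))) ⟩
    (sum λ j → sgn (suc j) * (A zero (suc j) * sum λ i → sgn i * (A (suc i) zero * D i j)))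
      ≈⟨ (sum-cong-≋ λ j → push (sgn (suc j)) (A zero (suc j)) λ i →
           sgn i * (A (suc i) zero * D i j)) ⟩
    (sum λ j → sum λ i → sgn (suc j) * (A zero (suc j) * (sgn i * (A (suc i) zero * D i j))))
      ≈⟨ (∑-comm λ j i →
           sgn (suc j) * (A zero (suc j) * (sgn i * (A (suc i) zero * D i j)))) ⟩
    (sum λ i → sum λ j → sgn (suc j) * (A zero (suc j) * (sgn i * (A (suc i) zero * D i j))))
      ≈⟨ (sum-cong-≋ λ i → sum-cong-≋ λ j →
           exchange (- 1#) (sgn j) (A zero (suc j)) (sgn i) (A (suc i) zero) (D i j)) ⟩
    (sum λ i → sum λ j → sgn (suc i) * (A (suc i) zero * (sgn j * (A zero (suc j) * D i j))))
      ≈⟨ (sum-cong-≋ λ i → push (sgn (suc i)) (A (suc i) zero) λ j →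
           sgn j * (A zero (suc j) * D i j)) ⟨
    (sum λ i → sgn (suc i) * (A (suc i) zero * ∣ minor A (suc i) zero ∣)) ∎)
    where
    D : Fin (suc n) → Fin (suc n) → Carrier
    D i j = ∣ (λ r s → A (suc (punchIn i r)) (suc (punchIn j s))) ∣

    push : ∀ {m} a b (f : Vector Carrier m) →
      a * (b * sum f) ≈ sum λ i → a * (b * f i)
    push a b f =
      trans (*-congˡ (*-distribˡ-sum b f)) (*-distribˡ-sum a λ i → b * f i)

    exchange : ∀ m s a t b d →
      (m * s) * (a * (t * (b * d))) ≈ (m * t) * (b * (s * (a * d)))
    exchange m s a t b d = begin
      (m * s) * (a * (t * (b * d)))  ≈⟨ *-assoc m s _ ⟩
      m * (s * (a * (t * (b * d))))  ≈⟨ *-congˡ (*-congˡ (x∙yz≈y∙xz a t _)) ⟩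
      m * (s * (t * (a * (b * d))))  ≈⟨ *-congˡ (x∙yz≈y∙xz s t _) ⟩
      m * (t * (s * (a * (b * d))))  ≈⟨ *-congˡ (*-congˡ (*-congˡ (x∙yz≈y∙xz a b d))) ⟩
      m * (t * (s * (b * (a * d))))  ≈⟨ *-congˡ (*-congˡ (x∙yz≈y∙xz s b _)) ⟩
      m * (t * (b * (s * (a * d))))  ≈⟨ *-assoc m t _ ⟨
      (m * t) * (b * (s * (a * d)))  ∎

  sgn₁ : ∀ x → (- 1# * 1#) * x ≈ - x
  sgn₁ x = trans (*-congʳ (*-identityʳ (- 1#))) (-1*x≈-x x)

  -- In the first-row expansion the first two terms have equal minors and opposite signs; every
  -- later minor still contains both equal columns and vanishes by induction.
  det-equal-columns : ∀ {n} (A : Matrix Carrier (suc (suc n))) →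
    (∀ i → A i zero ≈ A i (suc zero)) → ∣ A ∣ ≈ 0#
  det-equal-columns {n} A eq = begin
    1# * (A zero zero * m₀) + ((- 1# * 1#) * (A zero (suc zero) * m₁) + rest)
      ≈⟨ +-cong (*-identityˡ _) (+-cong (sgn₁ _) (sum-zero (vanish A eq))) ⟩
    A zero zero * m₀ + (- (A zero (suc zero) * m₁) + 0#)
      ≈⟨ +-cong (*-cong (eq zero) m₀≈m₁) (+-identityʳ _) ⟩
    A zero (suc zero) * m₁ + - (A zero (suc zero) * m₁)
      ≈⟨ -‿inverseʳ _ ⟩
    0# ∎
    where
    m₀   = ∣ minor A zero zero ∣
    m₁   = ∣ minor A zero (suc zero) ∣
    rest = sum λ j → sgn (suc (suc j)) *
      (A zero (suc (suc j)) * ∣ minor A zero (suc (suc j)) ∣)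

    m₀≈m₁ : m₀ ≈ m₁
    m₀≈m₁ = det-cong {A = minor A zero zero} {B = minor A zero (suc zero)} λ where
      i zero    → sym (eq (suc i))
      i (suc j) → refl

    vanish : ∀ {n} (A : Matrix Carrier (suc (suc n))) →
      (∀ i → A i zero ≈ A i (suc zero)) → ∀ j →
      sgn (suc (suc j)) * (A zero (suc (suc j)) * ∣ minor A zero (suc (suc j)) ∣) ≈ 0#
    vanish {suc n} A eq j = trans
      (*-congˡ (trans
        (*-congˡ (det-equal-columns (minor A zero (suc (suc j))) λ i → eq (suc i)))
        (zeroʳ _)))
      (zeroʳ _)

  mergeRows : ∀ {n} → Matrix Carrier (suc (suc n)) → Matrix Carrier (suc n)
  mergeRows A zero    s = A zero (suc s) + A (suc zero) (suc s)
  mergeRows A (suc r) s = A (suc (suc r)) (suc s)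

  -- Subtracting column 1 from column 0 leaves (y, - y, 0, …, 0) there.
  det-mergeRows : ∀ {n} (A : Matrix Carrier (suc (suc n))) y →
    A zero zero ≈ y + A zero (suc zero) →
    A (suc zero) zero + y ≈ A (suc zero) (suc zero) →
    (∀ i → A (suc (suc i)) zero ≈ A (suc (suc i)) (suc zero)) →
    ∣ A ∣ ≈ y * ∣ mergeRows A ∣
  det-mergeRows {n} A y eq₀ eq₁ eq = begin
    ∣ A ∣
      ≈⟨ det-column A ⟩
    1# * (A zero zero * m zero) +
      ((- 1# * 1#) * (A (suc zero) zero * m (suc zero)) +
        sum λ i → sgn (suc (suc i)) * (A (suc (suc i)) zero * m (suc (suc i))))
      ≈⟨ +-cong row₀ (+-cong row₁ (sum-cong-≋ λ i →
           *-congˡ {x = sgn (suc (suc i))} (*-congʳ {x = m (suc (suc i))} (eq i)))) ⟩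
    (y * m zero + u zero) + ((y * m (suc zero) + u (suc zero)) + sum λ i → u (suc (suc i)))
      ≈⟨ +-congˡ (+-assoc _ _ _) ⟩
    (y * m zero + u zero) + (y * m (suc zero) + (u (suc zero) + sum λ i → u (suc (suc i))))
      ≈⟨ interchange _ _ _ _ ⟩
    (y * m zero + y * m (suc zero)) + sum u
      ≈⟨ +-cong (sym (distribˡ y _ _)) sum-u ⟩
    y * (m zero + m (suc zero)) + 0#
      ≈⟨ +-identityʳ _ ⟩
    y * (m zero + m (suc zero))
      ≈⟨ *-congˡ merge ⟩
    y * ∣ mergeRows A ∣ ∎
    where
    m : Fin (suc (suc n)) → Carrier
    m i = ∣ minor A i zero ∣

    u : Fin (suc (suc n)) → Carrier
    u i = sgn i * (A i (suc zero) * m i)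

    -- `u` lists the column expansion of `A` with column 0 overwritten by column 1, so it sums to
    -- zero and only the multiples of `y` survive.
    doubled : Matrix Carrier (suc (suc n))
    doubled i zero    = A i (suc zero)
    doubled i (suc j) = A i (suc j)

    sum-u : sum u ≈ 0#
    sum-u = trans (sym (det-column doubled)) (det-equal-columns doubled λ _ → refl)

    row₀ : 1# * (A zero zero * m zero) ≈ y * m zero + u zero
    row₀ = begin
      1# * (A zero zero * m zero)                   ≈⟨ *-identityˡ _ ⟩
      A zero zero * m zero                          ≈⟨ *-congʳ eq₀ ⟩
      (y + A zero (suc zero)) * m zero              ≈⟨ distribʳ _ _ _ ⟩
      y * m zero + A zero (suc zero) * m zero       ≈⟨ +-congˡ (*-identityˡ _) ⟨
      y * m zero + u zero                           ∎

    row₁ : (- 1# * 1#) * (A (suc zero) zero * m (suc zero)) ≈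
           y * m (suc zero) + u (suc zero)
    row₁ = begin
      (- 1# * 1#) * p          ≈⟨ sgn₁ p ⟩
      - p                      ≈⟨ +-identityˡ _ ⟨
      0# + - p                 ≈⟨ +-congʳ (-‿inverseʳ q) ⟨
      (q + - q) + - p          ≈⟨ +-assoc _ _ _ ⟩
      q + (- q + - p)          ≈⟨ +-congˡ (trans (+-comm _ _) (-‿+-comm p q)) ⟩
      q + - (p + q)            ≈⟨ +-congˡ (-‿cong (trans (sym (distribʳ _ _ _)) (*-congʳ eq₁))) ⟩
      q + - (A (suc zero) (suc zero) * m (suc zero)) ≈⟨ +-congˡ (sgn₁ _) ⟨
      q + u (suc zero)         ∎
      where
      p = A (suc zero) zero * m (suc zero)
      q = y * m (suc zero)

    -- These two minors differ only in their first rows, so they add by linearity in that row.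
    merge : m zero + m (suc zero) ≈ ∣ mergeRows A ∣
    merge = trans (sym (∑-distrib-+ (term (suc zero)) (term zero)))
      (sum-cong-≋ λ j → begin
        term (suc zero) j + term zero j
          ≈⟨ distribˡ (sgn j) _ _ ⟨
        sgn j * (A (suc zero) (suc j) * d j + A zero (suc j) * d j)
          ≈⟨ *-congˡ (distribʳ (d j) _ _) ⟨
        sgn j * ((A (suc zero) (suc j) + A zero (suc j)) * d j)
          ≈⟨ *-congˡ (*-congʳ (+-comm _ _)) ⟩
        sgn j * ((A zero (suc j) + A (suc zero) (suc j)) * d j) ∎)
      where
      d : Fin (suc n) → Carrier
      d j = ∣ (λ r s → A (suc (suc r)) (suc (punchIn j s))) ∣
      term : Fin (suc (suc n)) → Fin (suc n) → Carrier
      term i j = sgn j * (A i (suc j) * d j)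

  det-isolated : ∀ {n} (A : Matrix Carrier (suc n)) →
    (∀ j → A zero (suc j) ≈ 0#) →
    ∣ A ∣ ≈ A zero zero * ∣ (λ i j → A (suc i) (suc j)) ∣
  det-isolated A eq = begin
    ∣ A ∣
      ≈⟨ +-cong (*-identityˡ _) (sum-zero λ j →
           *-zero-middle {sgn (suc j)} ∣ minor A zero (suc j) ∣ (eq j)) ⟩
    A zero zero * ∣ minor A zero zero ∣ + 0#
      ≈⟨ +-identityʳ _ ⟩
    A zero zero * ∣ minor A zero zero ∣ ∎

  module _ (a : Carrier) where

    firstOr : Carrier → ∀ {n} → Fin n → Carrier
    firstOr s zero    = s
    firstOr s (suc _) = a

    -- The determinant of twoBlock y (initial k) s is the product of the y + shift:
    -- merging the first two rows of a block splits off a factor y and adds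
    -- their off-diagonal entries.
    shifts : ∀ n → ℕ → Carrier → Vector Carrier n
    shifts zero          _             s = λ ()
    shifts (suc zero)    _             s = s ∷ λ ()
    shifts (suc (suc n)) zero          s = 0# ∷ shifts (suc n) zero (s + a)
    shifts (suc (suc n)) (suc zero)    s = s  ∷ shifts (suc n) zero a
    shifts (suc (suc n)) (suc (suc k)) s = 0# ∷ shifts (suc n) (suc k) (s + a)

    module _ (y : Carrier) where

      -- This is `y` times the identity plus `a` at every same-side pair, except that row zero
      -- carries `s` in place of `a`. Merging two rows alters only the first row, so the family is
      -- closed under it.
      twoBlock : ∀ {n} → (Fin n → Bool) → Carrier → Matrix Carrier n
      twoBlock χ s i j =
        (if does (i Fin.≟ j) then y else 0#) +
        (if does (χ i Bool.≟ χ j) then firstOr s i else 0#)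

      det-twoBlock-merge : ∀ {n} (χ : Fin (suc (suc n)) → Bool) s →
        χ zero ≡ χ (suc zero) →
        ∣ twoBlock χ s ∣ ≈ y * ∣ twoBlock (λ i → χ (suc i)) (s + a) ∣
      det-twoBlock-merge {n} χ s χ₀≡χ₁ = trans
        (det-mergeRows (twoBlock χ s) y eq₀ eq₁ eq)
        (*-congˡ (det-cong merged))
        where
        eq₀ : twoBlock χ s zero zero ≈ y + twoBlock χ s zero (suc zero)
        eq₀ rewrite χ₀≡χ₁ | dec-true (χ (suc zero) Bool.≟ χ (suc zero)) ≡.refl =
          +-congˡ (sym (+-identityˡ s))

        eq₁ : twoBlock χ s (suc zero) zero + y ≈ twoBlock χ s (suc zero) (suc zero)
        eq₁ rewrite χ₀≡χ₁ | dec-true (χ (suc zero) Bool.≟ χ (suc zero)) ≡.refl =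
          trans (+-comm _ _) (+-congˡ (+-identityˡ a))

        eq : ∀ i → twoBlock χ s (suc (suc i)) zero ≈ twoBlock χ s (suc (suc i)) (suc zero)
        eq i rewrite χ₀≡χ₁ = refl

        merged : ∀ i j → mergeRows (twoBlock χ s) i j ≈ twoBlock (λ i → χ (suc i)) (s + a) i j
        merged zero zero
          rewrite χ₀≡χ₁ | dec-true (χ (suc zero) Bool.≟ χ (suc zero)) ≡.refl = begin
          (0# + s) + (y + a)  ≈⟨ +-congʳ (+-identityˡ s) ⟩
          s + (y + a)         ≈⟨ x∙yz≈y∙xz+ s y a ⟩
          y + (s + a)         ∎
        merged zero (suc j) rewrite χ₀≡χ₁ with does (χ (suc zero) Bool.≟ χ (suc (suc j)))
        ... | true  = trans (+-congˡ (+-identityˡ a)) (+-assoc 0# s a)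
        ... | false = trans (+-congʳ (+-identityˡ 0#)) (+-identityˡ _)
        merged (suc i) j = refl

      -- The cases follow `shifts`: while the first two vertices share a side, merging them splits
      -- off `y`, recorded as `y + 0#`.
      det-twoBlock : ∀ n k s →
        ∣ twoBlock {n} (initial k) s ∣ ≈ product λ i → y + shifts n k s i
      det-twoBlock zero          k             s = refl
      det-twoBlock (suc zero)    k             s =
        trans (det-isolated (twoBlock (initial k) s) λ ()) (*-congʳ corner)
        where
        corner : twoBlock {1} (initial k) s zero zero ≈ y + s
        corner rewrite dec-true (initial {1} k zero Bool.≟ initial k zero) ≡.refl = refl
      det-twoBlock (suc (suc n)) zero          s = trans
        (det-twoBlock-merge {n} (initial zero) s ≡.refl)
        (*-cong (sym (+-identityʳ y)) (det-twoBlock (suc n) zero (s + a)))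
      -- Vertex zero is the last of its side, so its row vanishes off the diagonal: `y + s` splits
      -- off and the other side starts afresh with `a`.
      det-twoBlock (suc (suc n)) (suc zero)    s = trans
        (det-isolated (twoBlock {suc (suc n)} (initial 1) s) λ _ → +-identityˡ 0#)
        (*-congˡ (trans (det-cong restart) (det-twoBlock (suc n) zero a)))
        where
        restart : ∀ i j → twoBlock {suc (suc n)} (initial 1) s (suc i) (suc j) ≈
                          twoBlock (initial 0) a i j
        restart zero    j = refl
        restart (suc i) j = refl
      det-twoBlock (suc (suc n)) (suc (suc k)) s = trans
        (det-twoBlock-merge {n} (initial (suc (suc k))) s ≡.refl)
        (*-cong (sym (+-identityʳ y)) (det-twoBlock (suc n) (suc k) (s + a)))

open import Data.Nat.Base using (_+_; _*_)
open Defs using (ℝ; seq; _≃_; mk≃; close; fromℚ; fromℕ; Matrix; charPoly;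
                 Walk; []; dist; ecc; eccMatrix; least; walk?; IsSpectrum)

ℚ-ring : CommutativeRing _ _
ℚ-ring = ℚ.+-*-commutativeRing

ℚ-raw : RawRing _ _
ℚ-raw = CommutativeRing.rawRing ℚ-ring

open Determinant ℚ-ring using (shifts; twoBlock; firstOr; det-cong; det-twoBlock)
open SemiringSum (CommutativeRing.semiring ℚ-ring) using (sum; sum-cong-≗)
open RawSemiringDefs (RawRing.rawSemiring ℚ-raw) using (product; _^_)
open RawSemiringDefs (RawRing.rawSemiring Defs.ℝ-rawRing) using ()
  renaming (_^_ to _^ℝ_)

-- Equality of reals and reduction to rational terms

module ℝ-Properties where
  private module R = RawRing Defs.ℝ-rawRing

  pointwise⇒≃ : ∀ {x y} → (∀ m → seq x m ≡ seq y m) → x ≃ y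
  pointwise⇒≃ {x} {y} x≡y = mk≃ λ ε 0<ε → 0 , λ m _ →
    ≡.subst (λ p → ℚ.∣ p ∣ ℚ.< ε)
      (≡.trans (≡.sym (ℚ.+-inverseʳ (seq y m))) (≡.cong (ℚ._- seq y m) (≡.sym (x≡y m))))
      0<ε

  ≃-sym : ∀ {x y} → x ≃ y → y ≃ x
  ≃-sym {x} {y} x≃y = mk≃ λ ε 0<ε → let N , p = close x≃y ε 0<ε in
    N , λ m N≤m → ≡.subst (ℚ._< ε)
      (≡.trans (≡.sym (ℚ.∣-p∣≡∣p∣ (seq x m ℚ.- seq y m)))
               (≡.cong ℚ.∣_∣ (Defs.flip-sub (seq x m) (seq y m))))
      (p m N≤m)

  ≃-trans : ∀ {x y z} → x ≃ y → y ≃ z → x ≃ z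
  ≃-trans {x} {y} {z} x≃y y≃z = mk≃ λ ε 0<ε →
    let M , p = close x≃y _ (Defs.half-pos 0<ε)
        N , q = close y≃z _ (Defs.half-pos 0<ε)
    in M ⊔ N , λ m M⊔N≤m → begin-strict
      ℚ.∣ seq x m ℚ.- seq z m ∣
        ≡⟨ ≡.cong ℚ.∣_∣ (telescope (seq x m) (seq y m) (seq z m)) ⟩
      ℚ.∣ (seq x m ℚ.- seq y m) ℚ.+ (seq y m ℚ.- seq z m) ∣
        ≤⟨ ℚ.∣p+q∣≤∣p∣+∣q∣ (seq x m ℚ.- seq y m) (seq y m ℚ.- seq z m) ⟩
      ℚ.∣ seq x m ℚ.- seq y m ∣ ℚ.+ ℚ.∣ seq y m ℚ.- seq z m ∣
        <⟨ ℚ.+-mono-< (p m (ℕ.m⊔n≤o⇒m≤o M N M⊔N≤m)) (q m (ℕ.m⊔n≤o⇒n≤o M N M⊔N≤m)) ⟩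
      ℚ.½ ℚ.* ε ℚ.+ ℚ.½ ℚ.* ε
        ≡⟨ Defs.half+half ε ⟩
      ε ∎
    where
    open ℚ.≤-Reasoning
    open +-*-Solver
    telescope : ∀ a b c → a ℚ.- c ≡ (a ℚ.- b) ℚ.+ (b ℚ.- c)
    telescope = solve 3 (λ a b c → a :- c := (a :- b) :+ (b :- c)) ≡.refl

  -- If the distance of `p` and `q` were positive, closeness with that distance as tolerance would
  -- make it less than itself.
  fromℚ-injective : ∀ {p q} → fromℚ p ≃ fromℚ q → p ≡ q
  fromℚ-injective {p} {q} p≃q with ℚ.<-cmp 0ℚ ℚ.∣ p ℚ.- q ∣
  ... | tri< 0<d _ _ =
    let N , p≈q = close p≃q _ 0<d in contradiction (p≈q N ℕ.≤-refl) (ℚ.<-irrefl ≡.refl)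
  ... | tri≈ _ 0≡d _ = ≡.trans (Defs.sub-add p q)
    (≡.trans (≡.cong (ℚ._+ q) (ℚ.∣p∣≡0⇒p≡0 (p ℚ.- q) (≡.sym 0≡d))) (ℚ.+-identityˡ q))
  ... | tri> _ _ d<0 = contradiction (ℚ.<-≤-trans d<0 (ℚ.0≤∣p∣ (p ℚ.- q))) (ℚ.<-irrefl ≡.refl)

  seq-sum : ∀ {n} (v : Vector ℝ n) m → seq (Defs.sum v) m ≡ sum λ i → seq (v i) m
  seq-sum {zero}  v m = ≡.refl
  seq-sum {suc n} v m = ≡.cong (seq (v zero) m ℚ.+_) (seq-sum (v ∘ suc) m)

  seq-product : ∀ {n} (v : Vector ℝ n) m → seq (Defs.product v) m ≡ product λ i → seq (v i) m
  seq-product {zero}  v m = ≡.refl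
  seq-product {suc n} v m = ≡.cong (seq (v zero) m ℚ.*_) (seq-product (v ∘ suc) m)

  seq-^ : ∀ x k m → seq (x ^ℝ k) m ≡ seq x m ^ k
  seq-^ x zero    m = ≡.refl
  seq-^ x (suc k) m = ≡.cong (seq x m ℚ.*_) (seq-^ x k m)

  -- Real operations act term by term, so at each index a real determinant becomes a rational one,
  -- where equality is propositional.
  seq-det : ∀ {n} (A : Matrix ℝ n) m →
    seq (Defs.det Defs.ℝ-rawRing A) m ≡ Defs.det ℚ-raw λ i j → seq (A i j) m
  seq-det {zero}  A m = ≡.refl
  seq-det {suc n} A m = ≡.trans
    (seq-sum (λ j → ((R.- R.1#) ^ℝ toℕ j) R.*
      (A zero j R.* Defs.det Defs.ℝ-rawRing (λ r s → A (suc r) (punchIn j s)))) m)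
    (sum-cong-≗ λ j →
    ≡.cong₂ ℚ._*_ (seq-^ (R.- R.1#) (toℕ j) m)
      (≡.cong (seq (A zero j) m ℚ.*_) (seq-det (λ r s → A (suc r) (punchIn j s)) m)))

open ℝ-Properties

-- Products, maxima and shortest walks

open HeytingProperties ℚ.heytingCommutativeRing using (x#0y#0→xy#0)

product-cong : ∀ {n} {v w : Vector ℚ n} → (∀ i → v i ≡ w i) → product v ≡ product w
product-cong {zero}  v≡w = ≡.refl
product-cong {suc n} v≡w = ≡.cong₂ ℚ._*_ (v≡w zero) (product-cong (v≡w ∘ suc))

product-nonzero : ∀ {n} (v : Vector ℚ n) → (∀ i → v i ≢ 0ℚ) → product v ≢ 0ℚ
product-nonzero {zero}  v v≢0 ()
product-nonzero {suc n} v v≢0 =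
  x#0y#0→xy#0 (v≢0 zero) (product-nonzero (v ∘ suc) (v≢0 ∘ suc))

foldr-⊔-lub : ∀ {n b} (v : Vector ℕ n) → (∀ i → v i ≤ b) → foldr _⊔_ 0 v ≤ b
foldr-⊔-lub {zero}  v v≤b = z≤n
foldr-⊔-lub {suc n} v v≤b = ℕ.⊔-lub (v≤b zero) (foldr-⊔-lub (v ∘ suc) (v≤b ∘ suc))

foldr-⊔-upper : ∀ {n} (v : Vector ℕ n) i → v i ≤ foldr _⊔_ 0 v
foldr-⊔-upper v zero    = ℕ.m≤m⊔n (v zero) _
foldr-⊔-upper v (suc i) = ℕ.≤-trans (foldr-⊔-upper (v ∘ suc) i) (ℕ.m≤n⊔m (v zero) _)

-- Whatever walk `connected` supplies, `least` returns a minimum, and two minimal lengths bound each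
-- other.
dist-unique : ∀ {n} (G : Graph n) {u v k} → Walk (Graph.Adj G) k u v →
  (∀ j → Walk (Graph.Adj G) j u v → k ≤ j) → dist G u v ≡ k
dist-unique G {u} {v} {k} p k-min =
  let l , q = Graph.connected G u v
      d , r , d-min = least (λ k → walk? G k u v) l q
  in ℕ.≤-antisym (d-min k p) (k-min d r)

-- Eigenvalues, energy and characteristic value as rationals

-2ℚ 2ℚ 4ℚ : ℚ
-2ℚ = ℚ.- (ℤ.+ 2 ℚ./ 1)
2ℚ = ℤ.+ 2 ℚ./ 1
4ℚ = ℤ.+ 4 ℚ./ 1

shift : ∀ {n} → ℕ → Vector ℚ n
shift {n} k = shifts -2ℚ n k -2ℚ

-- Entry `i` is the root in x of the factor `(x + 2) + shift k i`.
eigenvalues : ∀ {n} → ℕ → Vector ℝ n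
eigenvalues k i = fromℚ (-2ℚ ℚ.- shift k i)

-- The ε-energy is the case `s = -2ℚ`; the accumulated entry `s` stays free for the induction in
-- `energy-step`.
energy : ℕ → ℕ → ℚ → ℚ
energy n k s = sum λ i → ℚ.∣ -2ℚ ℚ.- shifts -2ℚ n k s i ∣

-- The factor 4 + shift is x + 2 + shift at x = 2.
value-at-2 : ℕ → ℕ → ℚ
value-at-2 n k = product λ i → 4ℚ ℚ.+ shift {n} k i

-- Booleans stand for the two decisions and `w` for a `firstOr` entry that does not reduce at an
-- unknown row. On the diagonal, x = (x + 2) - 2.
charPoly-entry-cases : ∀ x (same-vertex same-side : Bool) {w} →
  (same-vertex ≡ true → same-side ≡ true) → w ≡ -2ℚ →
  x ℚ.* (if same-vertex then 1ℚ else 0ℚ) ℚ.-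
    (ℤ.+ (if same-vertex then 0 else if same-side then 2 else 0) ℚ./ 1) ≡
  (if same-vertex then x ℚ.+ 2ℚ else 0ℚ) ℚ.+ (if same-side then w else 0ℚ)
charPoly-entry-cases x true  true  _    ≡.refl =
  solve 1 (λ x → x :* con 1ℚ :- con 0ℚ := x :+ con 2ℚ :+ con -2ℚ) ≡.refl x
  where open +-*-Solver
charPoly-entry-cases x true  false same _      = contradiction (same ≡.refl) λ ()
charPoly-entry-cases x false true  _    ≡.refl = ≡.cong (ℚ._+ -2ℚ) (ℚ.*-zeroʳ x)
charPoly-entry-cases x false false _    _      = ≡.cong (ℚ._+ 0ℚ) (ℚ.*-zeroʳ x)

-- What is needed of K_k,n-k.  Working with a variable of this type, rather than
-- the graph constructed below, keeps the conversion checker from unfolding charPoly.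
CompleteBipartiteGraph : ℕ → ℕ → Set₁
CompleteBipartiteGraph n k = ∃ λ (G : Graph n) →
  (∀ u v → Graph.Adj G u v ⇔ initial k u ≢ initial k v) ×
  Defs.IsEnergy G (fromℚ (energy n k -2ℚ)) ×
  charPoly (eccMatrix G) (fromℚ 2ℚ) ≃ fromℚ (value-at-2 n k)

-- Distances and spectrum of a complete bipartite graph

module CompleteBipartite
  {n} (k : ℕ) (rep : Bool → Fin 2 → Fin n)
  (χ-rep : ∀ b i → initial k (rep b i) ≡ b) (rep-distinct : ∀ b → rep b 0F ≢ rep b 1F)
  where

  χ : Fin n → Bool
  χ = initial k

  opposite : ∀ u → ∃ λ w → χ u ≢ χ w
  opposite u = rep (not (χ u)) 0F , λ eq →
    Bool.not-¬ ≡.refl (≡.trans eq (χ-rep (not (χ u)) 0F))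

  -- A vertex coincides with at most one of the two representatives of its side; the other lies at
  -- distance 2 and makes the eccentricity 2.
  twin : ∀ u → ∃ λ w → u ≢ w × χ u ≡ χ w
  twin u with u Fin.≟ rep (χ u) 0F
  ... | no  u≢r = rep (χ u) 0F , u≢r , ≡.sym (χ-rep (χ u) 0F)
  ... | yes u≡r = rep (χ u) 1F , (λ u≡r′ → rep-distinct (χ u) (≡.trans (≡.sym u≡r) u≡r′)) ,
                  ≡.sym (χ-rep (χ u) 1F)

  two-steps : ∀ {u v} → χ u ≡ χ v → Walk (λ u v → χ u ≢ χ v) 2 u v
  two-steps {u} {v} eq = let w , u≢w = opposite u in
    u≢w Walk.∷ ((λ w≡v → u≢w (≡.trans eq (≡.sym w≡v))) Walk.∷ [])

  -- Abstract so that with-abstracting over χ u ≟ χ v leaves dist alone.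
  abstract
    connected : ∀ u v → ∃ λ k → Walk (λ u v → χ u ≢ χ v) k u v
    connected u v with χ u Bool.≟ χ v
    ... | yes eq  = 2 , two-steps eq
    ... | no  neq = 1 , neq Walk.∷ []

  graph : Graph n
  graph = record
    { Adj       = λ u v → χ u ≢ χ v
    ; adj?      = λ u v → ¬? (χ u Bool.≟ χ v)
    ; symmetric = λ u≢v → u≢v ∘ ≡.sym
    ; loopless  = λ u≡v χu≢χv → χu≢χv (≡.cong χ u≡v)
    ; connected = connected
    }

  dist-refl : ∀ u → dist graph u u ≡ 0
  dist-refl u = dist-unique graph [] λ _ _ → z≤n

  dist-adjacent : ∀ {u v} → χ u ≢ χ v → dist graph u v ≡ 1
  dist-adjacent neq = dist-unique graph (neq Walk.∷ []) λ where
    zero    []  → contradiction ≡.refl neq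
    (suc j) _   → s≤s z≤n

  dist-twin : ∀ {u v} → u ≢ v → χ u ≡ χ v → dist graph u v ≡ 2
  dist-twin u≢v eq = dist-unique graph (two-steps eq) λ where
    zero          []               → contradiction ≡.refl u≢v
    (suc zero)    (neq Walk.∷ [])  → contradiction eq neq
    (suc (suc j)) _                → s≤s (s≤s z≤n)

  dist-value : ∀ u v → dist graph u v ≡
    (if does (u Fin.≟ v) then 0 else if does (χ u Bool.≟ χ v) then 2 else 1)
  dist-value u v with u Fin.≟ v | χ u Bool.≟ χ v
  ... | yes ≡.refl | _      = dist-refl u
  ... | no u≢v     | yes eq = dist-twin u≢v eq
  ... | no _       | no neq = dist-adjacent neq

  dist≤2 : ∀ u v → dist graph u v ≤ 2
  dist≤2 u v rewrite dist-value u v with does (u Fin.≟ v) | does (χ u Bool.≟ χ v)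
  ... | true  | _     = z≤n
  ... | false | true  = ℕ.≤-refl
  ... | false | false = s≤s z≤n

  ecc≡2 : ∀ u → ecc graph u ≡ 2
  ecc≡2 u = let w , u≢w , eq = twin u in ℕ.≤-antisym
    (foldr-⊔-lub (dist graph u) (dist≤2 u))
    (≡.subst (_≤ ecc graph u) (dist-twin u≢w eq) (foldr-⊔-upper (dist graph u) w))

  -- Since all eccentricities are 2, only distance 2 survives: the 1 of adjacent pairs becomes 0.
  eccMatrix-entry : ∀ u v → eccMatrix graph u v ≡
    fromℕ (if does (u Fin.≟ v) then 0 else if does (χ u Bool.≟ χ v) then 2 else 0)
  eccMatrix-entry u v = ≡.trans
    (≡.cong₂ (λ d e → if does (d ℕ.≟ e) then fromℕ d else fromℕ 0)
      (dist-value u v) (≡.cong₂ _⊓_ (ecc≡2 u) (ecc≡2 v)))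
    (cases (does (u Fin.≟ v)) (does (χ u Bool.≟ χ v)))
    where
    cases : ∀ same-vertex same-side →
      (let d = if same-vertex then 0 else if same-side then 2 else 1 in
       if does (d ℕ.≟ 2) then fromℕ d else fromℕ 0) ≡
      fromℕ (if same-vertex then 0 else if same-side then 2 else 0)
    cases true  _     = ≡.refl
    cases false true  = ≡.refl
    cases false false = ≡.refl

  firstOr-const : ∀ {n} (i : Fin n) → firstOr -2ℚ -2ℚ i ≡ -2ℚ
  firstOr-const zero    = ≡.refl
  firstOr-const (suc i) = ≡.refl

  charPoly-entry : ∀ x m u v →
    seq (x Defs.* Defs.identity u v Defs.- eccMatrix graph u v) m ≡
    twoBlock -2ℚ (seq x m ℚ.+ 2ℚ) χ -2ℚ u v
  charPoly-entry x m u v = ≡.trans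
    (≡.cong₂ (λ p q → seq x m ℚ.* p ℚ.- q)
      (Bool.if-float (λ r → seq r m) (does (u Fin.≟ v)))
      (≡.cong (λ r → seq r m) (eccMatrix-entry u v)))
    (charPoly-entry-cases (seq x m) (does (u Fin.≟ v)) (does (χ u Bool.≟ χ v)) same (firstOr-const u))
    where
    same : does (u Fin.≟ v) ≡ true → does (χ u Bool.≟ χ v) ≡ true
    same eq with u Fin.≟ v
    ... | yes u≡v = dec-true (χ u Bool.≟ χ v) (≡.cong χ u≡v)

  charPoly-factors : ∀ x m → seq (charPoly (eccMatrix graph) x) m ≡
    product λ i → (seq x m ℚ.+ 2ℚ) ℚ.+ shift {n} k i
  charPoly-factors x m = begin
    seq (charPoly (eccMatrix graph) x) m
      ≡⟨ seq-det (λ i j → x Defs.* Defs.identity i j Defs.- eccMatrix graph i j) m ⟩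
    Defs.det ℚ-raw (λ i j → seq (x Defs.* Defs.identity i j Defs.- eccMatrix graph i j) m)
      ≡⟨ det-cong (charPoly-entry x m) ⟩
    Defs.det ℚ-raw (twoBlock -2ℚ (seq x m ℚ.+ 2ℚ) χ -2ℚ)
      ≡⟨ det-twoBlock -2ℚ (seq x m ℚ.+ 2ℚ) n k -2ℚ ⟩
    (product λ i → (seq x m ℚ.+ 2ℚ) ℚ.+ shift {n} k i) ∎
    where open ≡.≡-Reasoning

  charPoly-at-2 : charPoly (eccMatrix graph) (fromℚ 2ℚ) ≃
    fromℚ (value-at-2 n k)
  charPoly-at-2 = pointwise⇒≃ (charPoly-factors (fromℚ 2ℚ))

  spectrum : IsSpectrum (eccMatrix graph) (eigenvalues k)
  spectrum x = pointwise⇒≃ λ m → ≡.trans (charPoly-factors x m) (≡.sym (≡.trans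
    (seq-product (λ i → x Defs.- eigenvalues {n} k i) m)
    (product-cong λ i → factor (seq x m) (shift {n} k i))))
    where
    open +-*-Solver
    factor : ∀ x s → x ℚ.- (-2ℚ ℚ.- s) ≡ (x ℚ.+ 2ℚ) ℚ.+ s
    factor = solve 2 (λ x s → x :- (con -2ℚ :- s) := (x :+ con 2ℚ) :+ s) ≡.refl

  hasEnergy : Defs.IsEnergy graph (fromℚ (energy n k -2ℚ))
  hasEnergy = eigenvalues k , spectrum ,
    pointwise⇒≃ (seq-sum λ i → Defs.∣ eigenvalues {n} k i ∣)

  completeBipartite : CompleteBipartiteGraph n k
  completeBipartite = graph , (λ u v → ⇔-id _) , hasEnergy , charPoly-at-2

-- Equality of the energies

-- Only the last shift depends on `s`. As `s ≤ -2` keeps its eigenvalue nonnegative, lowering `s` by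
-- 2 adds exactly 2 to the absolute value.
energy-step : ∀ n s → s ℚ.≤ -2ℚ →
  energy (suc n) 0 (s ℚ.+ -2ℚ) ≡ 2ℚ ℚ.+ energy (suc n) 0 s
energy-step zero s s≤-2 = begin
  ℚ.∣ -2ℚ ℚ.- (s ℚ.+ -2ℚ) ∣ ℚ.+ 0ℚ
    ≡⟨ ≡.cong (λ p → ℚ.∣ p ∣ ℚ.+ 0ℚ) (regroup s) ⟩
  ℚ.∣ 2ℚ ℚ.+ (-2ℚ ℚ.- s) ∣ ℚ.+ 0ℚ
    ≡⟨ ≡.cong (ℚ._+ 0ℚ) (ℚ.0≤p⇒∣p∣≡p (ℚ.+-mono-≤ (ℚ.nonNegative⁻¹ 2ℚ) 0≤)) ⟩
  2ℚ ℚ.+ (-2ℚ ℚ.- s) ℚ.+ 0ℚ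
    ≡⟨ ℚ.+-assoc 2ℚ (-2ℚ ℚ.- s) 0ℚ ⟩
  2ℚ ℚ.+ (-2ℚ ℚ.- s ℚ.+ 0ℚ)
    ≡⟨ ≡.cong (λ p → 2ℚ ℚ.+ (p ℚ.+ 0ℚ)) (ℚ.0≤p⇒∣p∣≡p 0≤) ⟨
  2ℚ ℚ.+ (ℚ.∣ -2ℚ ℚ.- s ∣ ℚ.+ 0ℚ) ∎
  where
  open ≡.≡-Reasoning
  open +-*-Solver
  regroup : ∀ s → -2ℚ ℚ.- (s ℚ.+ -2ℚ) ≡ 2ℚ ℚ.+ (-2ℚ ℚ.- s)
  regroup = solve 1 (λ s → con -2ℚ :- (s :+ con -2ℚ) := con 2ℚ :+ (con -2ℚ :- s)) ≡.refl
  0≤ : 0ℚ ℚ.≤ -2ℚ ℚ.- s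
  0≤ = ≡.subst (ℚ._≤ -2ℚ ℚ.- s) (ℚ.+-inverseʳ s) (ℚ.+-monoˡ-≤ (ℚ.- s) s≤-2)
energy-step (suc n) s s≤-2 = ≡.cong (2ℚ ℚ.+_)
  (energy-step n (s ℚ.+ -2ℚ)
    (ℚ.≤-trans (ℚ.+-monoˡ-≤ -2ℚ s≤-2) (from-yes (-2ℚ ℚ.+ -2ℚ ℚ.≤? -2ℚ))))

-- The leading eigenvalues are -2, 2, -2 for k = 2 and -2, -2, 4 for k = 3. The remaining tails have
-- `s` equal to -4 and -2, and `energy-step` makes up the difference of 2.
energy-balance : ∀ {n} → 6 ≤ n → energy n 2 -2ℚ ≡ energy n 3 -2ℚ
energy-balance (s≤s (s≤s (s≤s (s≤s (s≤s (s≤s {n = m} _)))))) =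
  ≡.cong (λ e → 2ℚ ℚ.+ (2ℚ ℚ.+ e)) (begin
  2ℚ ℚ.+ energy (3 + m) 0 (-2ℚ ℚ.+ -2ℚ)
    ≡⟨ ≡.cong (2ℚ ℚ.+_) (energy-step (2 + m) -2ℚ ℚ.≤-refl) ⟩
  2ℚ ℚ.+ (2ℚ ℚ.+ energy (3 + m) 0 -2ℚ)
    ≡⟨ ℚ.+-assoc 2ℚ 2ℚ (energy (3 + m) 0 -2ℚ) ⟨
  4ℚ ℚ.+ energy (3 + m) 0 -2ℚ ∎)
  where open ≡.≡-Reasoning

-- The characteristic polynomial at 2

shifts≢-4 : ∀ n s → s ℚ.< ℚ.- 4ℚ → ∀ i → 4ℚ ℚ.+ shifts -2ℚ (suc n) 0 s i ≢ 0ℚ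
shifts≢-4 zero    s s<-4 zero    eq = ℚ.<-irrefl eq (ℚ.+-monoʳ-< 4ℚ s<-4)
shifts≢-4 (suc n) s s<-4 zero    ()
shifts≢-4 (suc n) s s<-4 (suc i) = shifts≢-4 n (s ℚ.+ -2ℚ)
  (ℚ.<-trans (ℚ.+-monoˡ-< -2ℚ s<-4) (from-yes (ℚ.- 4ℚ ℚ.+ -2ℚ ℚ.<? ℚ.- 4ℚ))) i

-- The side of size two yields the shift -4, so the second factor is 0.
value-at-2≡0 : ∀ {n} → 6 ≤ n → value-at-2 n 2 ≡ 0ℚ
value-at-2≡0 (s≤s (s≤s (s≤s {n = n} _))) =
  ≡.cong (4ℚ ℚ.*_) (ℚ.*-zeroˡ (product λ i → 4ℚ ℚ.+ shifts -2ℚ (suc n) 0 -2ℚ i))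

value-at-2≢0 : ∀ {n} → 6 ≤ n → value-at-2 n 3 ≢ 0ℚ
value-at-2≢0 (s≤s (s≤s (s≤s (s≤s (s≤s (s≤s {n = m} _)))))) =
  product-nonzero (λ i → 4ℚ ℚ.+ shift {6 + m} 3 i) λ where
    zero                              ()
    (suc zero)                        ()
    (suc (suc zero))                  ()
    (suc (suc (suc zero)))            ()
    (suc (suc (suc (suc zero))))      ()
    -- The first five shifts are 0, 0, -6, 0, 0. By then the second side, of at least three vertices
    -- since `6 ≤ n`, has accumulated -6.
    (suc (suc (suc (suc (suc i))))) → shifts≢-4 m (-2ℚ ℚ.+ -2ℚ ℚ.+ -2ℚ)
      (from-yes (-2ℚ ℚ.+ -2ℚ ℚ.+ -2ℚ ℚ.<? ℚ.- 4ℚ)) i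

-- Representatives of the two sides

initial⇒< : ∀ {n} k (i : Fin n) → initial k i ≡ true → toℕ i < k
initial⇒< (suc k) zero    eq = s≤s z≤n
initial⇒< (suc k) (suc i) eq = s≤s (initial⇒< k i eq)

initial-inject≤ : ∀ {m n} k (i : Fin m) (m≤n : m ≤ n) → initial k (inject≤ i m≤n) ≡ initial k i
initial-inject≤ zero    i       m≤n       = ≡.refl
initial-inject≤ (suc k) zero    (s≤s m≤n) = ≡.refl
initial-inject≤ (suc k) (suc i) (s≤s m≤n) = initial-inject≤ k i m≤n

module Representatives {n} (6≤n : 6 ≤ n) where

  vertex : Fin 6 → Fin n
  vertex i = inject≤ i 6≤n

  -- Positions 0, 1, 2 and 3, 4, 5 are the two sides for k = 3. For k = 2 position 2 changes sides,
  -- so only the first two of each triple serve there.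
  slot : Bool → Fin 3 → Fin 6
  slot true  i = i ↑ˡ 3
  slot false i = 3 ↑ʳ i

  representative : Bool → Fin 3 → Fin n
  representative b i = vertex (slot b i)

  representative-injective : ∀ b {i j} → representative b i ≡ representative b j → i ≡ j
  representative-injective b eq = slot-injective b (Fin.inject≤-injective 6≤n 6≤n _ _ eq)
    where
    slot-injective : ∀ b {i j} → slot b i ≡ slot b j → i ≡ j
    slot-injective true  = Fin.↑ˡ-injective 3 _ _
    slot-injective false = Fin.↑ʳ-injective 3 _ _

  representative-distinct : ∀ b → representative b 0F ≢ representative b 1F
  representative-distinct b eq = contradiction (representative-injective b eq) λ ()

  representative-side₂ : ∀ b (i : Fin 2) → initial 2 (representative b (i ↑ˡ 1)) ≡ b
  representative-side₂ b i = ≡.trans (initial-inject≤ 2 (slot b (i ↑ˡ 1)) 6≤n) (side b i)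
    where
    side : ∀ b i → initial 2 (slot b (i ↑ˡ 1)) ≡ b
    side true  0F = ≡.refl
    side true  1F = ≡.refl
    side false i  = ≡.refl

  representative-side₃ : ∀ b i → initial 3 (representative b i) ≡ b
  representative-side₃ b i = ≡.trans (initial-inject≤ 3 (slot b i) 6≤n) (side b i)
    where
    side : ∀ b i → initial 3 (slot b i) ≡ b
    side true  0F = ≡.refl
    side true  1F = ≡.refl
    side true  2F = ≡.refl
    side false i  = ≡.refl

  K₂ : CompleteBipartiteGraph n 2
  K₂ = CompleteBipartite.completeBipartite 2 (λ b i → representative b (i ↑ˡ 1))
    representative-side₂ representative-distinct

  K₃ : CompleteBipartiteGraph n 3
  K₃ = CompleteBipartite.completeBipartite 3 (λ b i → representative b (i ↑ˡ 1))
    (λ b i → representative-side₃ b (i ↑ˡ 1)) representative-distinct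

-- Comparison of the two graphs

equienergetic : ∀ {n} → 6 ≤ n → (G H : Graph n) →
  Defs.IsEnergy G (fromℚ (energy n 2 -2ℚ)) →
  Defs.IsEnergy H (fromℚ (energy n 3 -2ℚ)) → Equienergetic G H
equienergetic {n} 6≤n G H energyG energyH = fromℚ (energy n 2 -2ℚ) , energyG ,
  ≡.subst (λ e → Defs.IsEnergy H (fromℚ e)) (≡.sym (energy-balance 6≤n)) energyH

-- 2 is an ε-eigenvalue of K₂,ₙ₋₂ but not of K₃,ₙ₋₃.
not-cospectral : ∀ {n} → 6 ≤ n → (G H : Graph n) →
  charPoly (eccMatrix G) (fromℚ 2ℚ) ≃ fromℚ (value-at-2 n 2) →
  charPoly (eccMatrix H) (fromℚ 2ℚ) ≃ fromℚ (value-at-2 n 3) →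
  ¬ Defs.SameSpectrum G H
not-cospectral {n} 6≤n G H atG atH (λs , spectrumG , spectrumH) = value-at-2≢0 6≤n
  (≡.trans (≡.sym (fromℚ-injective equal)) (value-at-2≡0 6≤n))
  where
  equal : fromℚ (value-at-2 n 2) ≃ fromℚ (value-at-2 n 3)
  equal = ≃-trans (≃-sym atG) (≃-trans (spectrumG (fromℚ 2ℚ))
    (≃-trans (≃-sym (spectrumH (fromℚ 2ℚ))) atH))

-- An isomorphism would map the side of size two of K₂,ₙ₋₂ onto a side of
-- K₃,ₙ₋₃, which has at least three elements.
not-isomorphic : ∀ {n} → 6 ≤ n → (G H : Graph n) →
  (∀ u v → Graph.Adj G u v ⇔ initial 2 u ≢ initial 2 v) →
  (∀ u v → Graph.Adj H u v ⇔ initial 3 u ≢ initial 3 v) →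
  ¬ Defs.Isomorphic G H
not-isomorphic {n} 6≤n G H adjacent₂ adjacent₃ (π , iso) =
  let i , j , i<j , eq = Fin.pigeonhole (s≤s (s≤s (s≤s z≤n))) position
  in Fin.<⇒≢ i<j (representative-injective side (preimage-injective
       (Fin.toℕ-injective (≡.trans (≡.sym (Fin.toℕ-fromℕ< (preimage<2 i)))
         (≡.trans (≡.cong toℕ eq) (Fin.toℕ-fromℕ< (preimage<2 j)))))))
  where
  open Representatives 6≤n

  base : Fin n
  base = representative true 0F

  side : Bool
  side = initial 3 (π ⟨$⟩ʳ base)

  -- The image of `base` may fall on either side; both have three representatives, which are pulled
  -- back and forced into the two vertices on the side of `base`.
  preimage : Fin 3 → Fin n
  preimage i = π ⟨$⟩ˡ representative side i

  preimage-injective : ∀ {i j} → preimage i ≡ preimage j →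
    representative side i ≡ representative side j
  preimage-injective eq =
    ≡.trans (≡.sym (inverseʳ π)) (≡.trans (≡.cong (π ⟨$⟩ʳ_) eq) (inverseʳ π))

  preimage<2 : ∀ i → toℕ (preimage i) < 2
  preimage<2 i = initial⇒< 2 (preimage i) (≡.trans
    -- Otherwise the preimage would be adjacent to `base`, and its image adjacent to a vertex on its
    -- own side.
    (decidable-stable (initial 2 (preimage i) Bool.≟ initial 2 base) λ neq →
      Equivalence.to (adjacent₃ (π ⟨$⟩ʳ preimage i) (π ⟨$⟩ʳ base))
        (Equivalence.to (iso (preimage i) base)
          (Equivalence.from (adjacent₂ (preimage i) base) neq))
        (≡.trans (≡.cong (initial 3) (inverseʳ π)) (representative-side₃ side i)))
    (representative-side₂ true 0F))

  position : Fin 3 → Fin 2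
  position i = fromℕ< (preimage<2 i)

pair : ∀ {n} → 6 ≤ n → CompleteBipartiteGraph n 2 → CompleteBipartiteGraph n 3 →
  ∃₂ λ (G H : Graph n) → NonCospectral G H × Equienergetic G H
pair 6≤n (G , adjacentG , energyG , atG) (H , adjacentH , energyH , atH) = G , H ,
  (not-isomorphic 6≤n G H adjacentG adjacentH , not-cospectral 6≤n G H atG atH) ,
  equienergetic 6≤n G H energyG energyH

theorem5p3 : ∀ (t : ℕ) → 3 ≤ t →
    ∃₂ λ (G H : Graph (6 * t + 1)) → NonCospectral G H × Equienergetic G H
theorem5p3 t 3≤t = pair 6≤6t+1 (K₂ 6≤6t+1) (K₃ 6≤6t+1)
  where
  open Representatives using (K₂; K₃)
  6≤6t+1 : 6 ≤ 6 * t + 1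
  6≤6t+1 = ℕ.≤-trans (ℕ.*-monoʳ-≤ 6 (ℕ.≤-trans (s≤s z≤n) 3≤t)) (ℕ.m≤m+n (6 * t) 1)
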